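{- Let $w\in S_\infty$ and $i\geq1$ with $\ell(s_iw)>\ell(w)$. Then for every $l\geq1$ the set $A_l(s_iw)$ is the disjoint union of $A_l(w)$ and $\{s_i\alpha:\alpha\in A_{l,i}(w)\}$, and the latter set is non-empty for at least one value of $l$. In particular $A_l(w)\subseteq A_l(s_iw)$ for every $l$, the set $A_l(s_iw)$ is preserved under $\alpha\mapsto s_i\alpha$ for every $l$, and $A(w)\subsetneq A(s_iw)$.
   Context: $S_n$ is the symmetric group on $\{1,\dots,n\}$, viewed inside $S_{n+1}$ as the stabilizer of $n+1$, and $S_\infty=\bigcup_n S_n$. Permutations compose as functions, $(uv)(x)=u(v(x))$. $s_i$ is the simple transposition interchanging $i$ and $i+1$, and $\ell(w)$ is the length of $w$ (number of inversions). For $l\geq1$, $w^l=(w^l_1<\dots<w^l_l)$ is the increasing ordering of $w(1),\dots,w(l)$. For strictly increasing sequences $\alpha,\gamma$ of the same length write $\alpha\leq\gamma$ if $\alpha_j\leq\gamma_j$ for all $j$. $A_l(w)$ is the set of strictly increasing sequences $\alpha$ of $l$ positive integers with $\alpha\leq w^l$, and $A(w)=\bigcup_{l\geq1}A_l(w)$. For an increasing sequence $\alpha$, $s_i\alpha$ is the increasing sequence whose set of entries is $\{s_i(\alpha_1),\dots,s_i(\alpha_l)\}$. $A_{l,i}(w):=\{\alpha\in A_l(w): s_i\alpha\notin A_l(w)\}$. -}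

module Defs where

open import Data.Nat using (ℕ; zero; suc; _+_; _≤_; _<_; _<ᵇ_; _⊔_; z≤n; s≤s)
open import Data.Nat.Properties using (_≟_; m⊔n≤o⇒m≤o; m⊔n≤o⇒n≤o; <⇒≢; ≤⇒≯)
open import Data.Bool using (if_then_else_)
open import Data.Fin as Fin using (Fin)
open import Data.List using (List; map; upTo)
open import Data.Nat.ListAction using (sum)
open import Data.Vec using (Vec; []; _∷_; lookup; tabulate)
import Data.Vec as Vec
open import Data.Product using (Σ; _×_; _,_)
open import Data.Empty using (⊥-elim)
open import Relation.Nullary using (¬_; yes; no)
open import Relation.Binary.PropositionalEquality using (_≡_; refl; sym; trans; cong)

-- Positive integers are the elements 1,2,3,… of ℕ; a permutation is a
-- bijection of ℕ fixing 0 (so it restricts to a bijection of the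
-- positive integers) that is the identity from some bound on.

record Perm : Set where
  field
    fun     : ℕ → ℕ
    inv     : ℕ → ℕ
    fun-inv : ∀ x → fun (inv x) ≡ x
    inv-fun : ∀ x → inv (fun x) ≡ x
    fix0    : fun 0 ≡ 0
    bound   : ℕ
    support : ∀ x → bound ≤ x → fun x ≡ x
open Perm public

swap : ℕ → ℕ → ℕ
swap i x with x ≟ i
... | yes _ = suc i
... | no _ with x ≟ suc i
...   | yes _ = i
...   | no _ = x

swap-i : ∀ i → swap i i ≡ suc i
swap-i i with i ≟ i
... | yes _ = refl
... | no ne = ⊥-elim (ne refl)

swap-si : ∀ i → swap i (suc i) ≡ i
swap-si i with suc i ≟ i
... | yes e = ⊥-elim (<⇒≢ (Data.Nat.Properties.n<1+n i) (sym e))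
... | no _ with suc i ≟ suc i
...   | yes _ = refl
...   | no ne = ⊥-elim (ne refl)

swap-other : ∀ i x → ¬ x ≡ i → ¬ x ≡ suc i → swap i x ≡ x
swap-other i x n1 n2 with x ≟ i
... | yes e = ⊥-elim (n1 e)
... | no _ with x ≟ suc i
...   | yes e = ⊥-elim (n2 e)
...   | no _ = refl

swap-invol : ∀ i x → swap i (swap i x) ≡ x
swap-invol i x with x ≟ i
... | yes refl = swap-si i
... | no n1 with x ≟ suc i
...   | yes refl = swap-i i
...   | no n2 = swap-other i x n1 n2

s : (i : ℕ) → 1 ≤ i → Perm
s i 1≤i = record
  { fun = swap i ; inv = swap i
  ; fun-inv = swap-invol i ; inv-fun = swap-invol i
  ; fix0 = swap-other i 0 (λ e → <⇒≢ 1≤i e) (λ ())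
  ; bound = suc (suc i)
  ; support = λ x le → swap-other i x
      (λ { refl → ≤⇒≯ le (s≤s (Data.Nat.Properties.n≤1+n i)) })
      (λ { refl → ≤⇒≯ le (Data.Nat.Properties.n<1+n (suc i)) }) }

_∘ₚ_ : Perm → Perm → Perm
u ∘ₚ v = record
  { fun = λ x → fun u (fun v x)
  ; inv = λ x → inv v (inv u x)
  ; fun-inv = λ x → trans (cong (fun u) (fun-inv v (inv u x))) (fun-inv u x)
  ; inv-fun = λ x → trans (cong (inv v) (inv-fun u (fun v x))) (inv-fun v x)
  ; fix0 = trans (cong (fun u) (fix0 v)) (fix0 u)
  ; bound = bound u ⊔ bound v
  ; support = λ x le → trans (cong (fun u) (support v x (m⊔n≤o⇒n≤o (bound u) (bound v) le)))
                             (support u x (m⊔n≤o⇒m≤o (bound u) (bound v) le)) }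

sw : (i : ℕ) → 1 ≤ i → Perm → Perm
sw i 1≤i w = s i 1≤i ∘ₚ w

-- Length ℓ(w) = number of inversions: pairs a < b with w(a) > w(b).
-- It suffices to count pairs below the support bound (0 is fixed and
-- never involved in an inversion).

indicator : ℕ → ℕ → ℕ
indicator m n = if m <ᵇ n then 1 else 0

inversionsBelow : ℕ → (ℕ → ℕ) → ℕ
inversionsBelow N f =
  sum (map (λ b → sum (map (λ a → indicator (f b) (f a)) (upTo b))) (upTo N))

ℓ : Perm → ℕ
ℓ w = inversionsBelow (bound w) (fun w)

insert : {n : ℕ} → ℕ → Vec ℕ n → Vec ℕ (suc n)
insert x [] = x ∷ []
insert x (y ∷ ys) with x Data.Nat.≤? y
... | yes _ = x ∷ y ∷ ys
... | no _ = y ∷ insert x ys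

sort : {n : ℕ} → Vec ℕ n → Vec ℕ n
sort [] = []
sort (x ∷ xs) = insert x (sort xs)

wl : Perm → (l : ℕ) → Vec ℕ l
wl w l = sort (tabulate (λ (j : Fin l) → fun w (suc (Fin.toℕ j))))

IncPos : {l : ℕ} → Vec ℕ l → Set
IncPos {l} α = (∀ (j : Fin l) → 1 ≤ lookup α j)
             × (∀ (j k : Fin l) → j Fin.< k → lookup α j < lookup α k)

_≤ᵥ_ : {l : ℕ} → Vec ℕ l → Vec ℕ l → Set
_≤ᵥ_ {l} α γ = ∀ (j : Fin l) → lookup α j ≤ lookup γ j

InA : Perm → (l : ℕ) → Vec ℕ l → Set
InA w l α = IncPos α × α ≤ᵥ wl w l

sα : ℕ → {l : ℕ} → Vec ℕ l → Vec ℕ l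
sα i α = sort (Vec.map (swap i) α)

InAi : Perm → (l i : ℕ) → Vec ℕ l → Set
InAi w l i α = InA w l α × ¬ InA w l (sα i α)

{-# OPTIONS --safe #-}

-- If ℓ(sᵢw) > ℓ(w) then w⁻¹(i) < w⁻¹(i+1), since otherwise every inversion of sᵢw is an
-- inversion of w. Hence (sᵢw)^l = sᵢ(w^l), and w^l never contains i+1 without i. If w^l
-- contains both or neither, sᵢ fixes w^l and A_l(w) is closed under sᵢ, so A_{l,i}(w) is
-- empty. Otherwise w^l contains i, at some position k, but not i+1, and (sᵢw)^l raises that
-- entry to i+1. Then α ≤ (sᵢw)^l has either α_k ≤ i, so α ≤ w^l, or α_k = i+1, and lowering
-- α_k to i gives β ∈ A_{l,i}(w) with sᵢβ = α. For l = w⁻¹(i) this happens with β = w^l.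

module Submission where

open import Defs
open import Data.Nat using (ℕ; zero; suc; _+_; _∸_; _≤_; _<_; _<ᵇ_; _⊔_; _≤?_; _<?_; z≤n; s≤s)
open import Data.Nat.Properties
open import Data.Bool using (true; false)
open import Data.List using (map; upTo; _++_; [_])
open import Data.List.Properties using (upTo-∷ʳ; map-++)
open import Data.Nat.ListAction using (sum)
open import Data.Nat.ListAction.Properties using (sum-++)
open import Data.Fin as Fin using (Fin; zero; suc; toℕ)
import Data.Fin.Properties as FinP
open import Data.Vec as Vec using (Vec; []; _∷_; lookup; tabulate; _[_]≔_)
open import Data.Vec.Properties
  using (lookup∘update; lookup∘update′; []≔-idempotent; []≔-lookup; lookup-map; lookup∘tabulate; tabulate-∘)
open import Data.Product using (Σ; ∃; _×_; _,_; proj₁; proj₂)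
open import Data.Sum using (_⊎_; inj₁; inj₂)
open import Function using (_∘_; id)
open import Function.Definitions using (Injective)
open import Relation.Nullary using (¬_; Dec; yes; no; contradiction)
open import Relation.Nullary.Reflects using (ofʸ; ofⁿ)
open import Relation.Binary using (tri<; tri≈; tri>)
open import Relation.Binary.PropositionalEquality hiding ([_])

-- Inversion counts

sum-upTo-suc : ∀ (f : ℕ → ℕ) n → sum (map f (upTo (suc n))) ≡ sum (map f (upTo n)) + f n
sum-upTo-suc f n = begin
  sum (map f (upTo (suc n)))       ≡⟨ cong (sum ∘ map f) (sym (upTo-∷ʳ n)) ⟩
  sum (map f (upTo n ++ [ n ]))    ≡⟨ cong sum (map-++ f (upTo n) [ n ]) ⟩
  sum (map f (upTo n) ++ [ f n ])  ≡⟨ sum-++ (map f (upTo n)) [ f n ] ⟩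
  sum (map f (upTo n)) + (f n + 0) ≡⟨ cong (sum (map f (upTo n)) +_) (+-identityʳ (f n)) ⟩
  sum (map f (upTo n)) + f n       ∎
  where open ≡-Reasoning

sum-upTo-mono : ∀ {f g : ℕ → ℕ} n → (∀ a → a < n → f a ≤ g a) →
                sum (map f (upTo n)) ≤ sum (map g (upTo n))
sum-upTo-mono zero h = z≤n
sum-upTo-mono {f} {g} (suc n) h =
  subst₂ _≤_ (sym (sum-upTo-suc f n)) (sym (sum-upTo-suc g n))
    (+-mono-≤ (sum-upTo-mono n (λ a a<n → h a (m<n⇒m<1+n a<n))) (h n ≤-refl))

sum-upTo-zero : ∀ {f : ℕ → ℕ} n → (∀ a → a < n → f a ≡ 0) → sum (map f (upTo n)) ≡ 0
sum-upTo-zero zero h = refl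
sum-upTo-zero {f} (suc n) h = begin
  sum (map f (upTo (suc n)))  ≡⟨ sum-upTo-suc f n ⟩
  sum (map f (upTo n)) + f n  ≡⟨ cong₂ _+_ (sum-upTo-zero n (λ a a<n → h a (m<n⇒m<1+n a<n))) (h n ≤-refl) ⟩
  0                           ∎
  where open ≡-Reasoning

indicator-mono : ∀ {m n m′ n′} → (m < n → m′ < n′) → indicator m n ≤ indicator m′ n′
indicator-mono {m} {n} {m′} {n′} h
  with m <ᵇ n | <ᵇ-reflects-< m n | m′ <ᵇ n′ | <ᵇ-reflects-< m′ n′
... | false | _        | _     | _          = z≤n
... | true  | _        | true  | _          = ≤-refl
... | true  | ofʸ m<n  | false | ofⁿ m′≮n′  = contradiction (h m<n) m′≮n′

indicator-≮ : ∀ {m n} → ¬ m < n → indicator m n ≡ 0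
indicator-≮ m≮n = n≤0⇒n≡0 (indicator-mono {m′ = 0} {n′ = 0} (λ m<n → contradiction m<n m≮n))

data SwapView (i x : ℕ) : Set where
  at-i     : x ≡ i → swap i x ≡ suc i → SwapView i x
  at-suc-i : x ≡ suc i → swap i x ≡ i → SwapView i x
  elsewhere : x ≢ i → x ≢ suc i → swap i x ≡ x → SwapView i x

swapView : ∀ i x → SwapView i x
swapView i x with x ≟ i
... | yes refl = at-i refl (swap-i i)
... | no x≢i with x ≟ suc i
...   | yes refl = at-suc-i refl (swap-si i)
...   | no x≢1+i = elsewhere x≢i x≢1+i (swap-other i x x≢i x≢1+i)

swap-reflects-< : ∀ i {x y} → swap i x < swap i y → x < y ⊎ (x ≡ suc i × y ≡ i)
swap-reflects-< i {x} {y} lt with swapView i x | swapView i y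
... | at-i refl sx     | at-i refl sy     = contradiction (subst₂ _<_ sx sy lt) (<-irrefl refl)
... | at-i refl _      | at-suc-i refl _  = inj₁ (n<1+n i)
... | at-i refl sx     | elsewhere _ _ sy = inj₁ (<-trans (n<1+n i) (subst₂ _<_ sx sy lt))
... | at-suc-i refl _  | at-i refl _      = inj₂ (refl , refl)
... | at-suc-i refl sx | at-suc-i refl sy = contradiction (subst₂ _<_ sx sy lt) (<-irrefl refl)
... | at-suc-i refl sx | elsewhere _ y≢1+i sy =
  inj₁ (≤∧≢⇒< (subst₂ _<_ sx sy lt) (y≢1+i ∘ sym))
... | elsewhere x≢i _ sx | at-i refl sy   = inj₁ (≤∧≢⇒< (≤-pred (subst₂ _<_ sx sy lt)) x≢i)
... | elsewhere _ _ sx | at-suc-i refl sy = inj₁ (m<n⇒m<1+n (subst₂ _<_ sx sy lt))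
... | elsewhere _ _ sx | elsewhere _ _ sy = inj₁ (subst₂ _<_ sx sy lt)

module _ (w : Perm) where

  fun-injective : ∀ {x y} → fun w x ≡ fun w y → x ≡ y
  fun-injective {x} {y} e = trans (sym (inv-fun w x)) (trans (cong (inv w) e) (inv-fun w y))

  fun≡⇒≡inv : ∀ {a x} → fun w a ≡ x → a ≡ inv w x
  fun≡⇒≡inv {a} e = trans (sym (inv-fun w a)) (cong (inv w) e)

  fun-<-bound : ∀ {a} → a < bound w → fun w a < bound w
  fun-<-bound {a} a<N with fun w a <? bound w
  ... | yes fa<N = fa<N
  ... | no fa≮N = contradiction a<N (≤⇒≯ (subst (bound w ≤_) fa≡a (≮⇒≥ fa≮N)))
    where
    fa≡a : fun w a ≡ a
    fa≡a = fun-injective (support w (fun w a) (≮⇒≥ fa≮N))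

inversionsBelow-stable : ∀ {f : ℕ → ℕ} {N} → (∀ x → N ≤ x → f x ≡ x) →
                         (∀ a → a < N → f a < N) → ∀ d → inversionsBelow (d + N) f ≡ inversionsBelow N f
inversionsBelow-stable fixed closed zero = refl
inversionsBelow-stable {f} {N} fixed closed (suc d) = begin
  inversionsBelow (suc d + N) f                    ≡⟨ sum-upTo-suc _ (d + N) ⟩
  inversionsBelow (d + N) f + inversionsAt (d + N) ≡⟨ cong₂ _+_ (inversionsBelow-stable fixed closed d)
                                                                (sum-upTo-zero (d + N) no-inversion) ⟩
  inversionsBelow N f + 0                          ≡⟨ +-identityʳ _ ⟩
  inversionsBelow N f                              ∎
  where
  open ≡-Reasoning
  inversionsAt : ℕ → ℕ
  inversionsAt b = sum (map (λ a → indicator (f b) (f a)) (upTo b))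
  N≤d+N : N ≤ d + N
  N≤d+N = m≤n+m N d
  fa≤d+N : ∀ a → a < d + N → f a ≤ d + N
  fa≤d+N a a<d+N with a <? N
  ... | yes a<N = <⇒≤ (<-≤-trans (closed a a<N) N≤d+N)
  ... | no a≮N = subst (_≤ d + N) (sym (fixed a (≮⇒≥ a≮N))) (<⇒≤ a<d+N)
  no-inversion : ∀ a → a < d + N → indicator (f (d + N)) (f a) ≡ 0
  no-inversion a a<d+N =
    indicator-≮ (≤⇒≯ (subst (f a ≤_) (sym (fixed (d + N) N≤d+N)) (fa≤d+N a a<d+N)))

ℓ-beyond-bound : ∀ w {M} → bound w ≤ M → inversionsBelow M (fun w) ≡ ℓ w
ℓ-beyond-bound w {M} N≤M = begin
  inversionsBelow M (fun w)
    ≡⟨ cong (λ m → inversionsBelow m (fun w)) (sym (m∸n+n≡m N≤M)) ⟩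
  inversionsBelow (M ∸ bound w + bound w) (fun w)
    ≡⟨ inversionsBelow-stable (support w) (λ _ → fun-<-bound w) (M ∸ bound w) ⟩
  ℓ w
    ∎
  where open ≡-Reasoning

inversionsBelow-swap-≤ : ∀ i (f : ℕ → ℕ) N → (∀ {a b} → a < b → f a ≡ i → f b ≢ suc i) →
                         inversionsBelow N (swap i ∘ f) ≤ inversionsBelow N f
inversionsBelow-swap-≤ i f N no-ascent =
  sum-upTo-mono N (λ b _ → sum-upTo-mono b (λ a a<b → indicator-mono (reflect a<b)))
  where
  reflect : ∀ {a b} → a < b → swap i (f b) < swap i (f a) → f b < f a
  reflect a<b lt with swap-reflects-< i lt
  ... | inj₁ fb<fa = fb<fa
  ... | inj₂ (fb≡1+i , fa≡i) = contradiction fb≡1+i (no-ascent a<b fa≡i)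

inv-<-from-ℓ-< : ∀ w i (1≤i : 1 ≤ i) → ℓ w < ℓ (sw i 1≤i w) → inv w i < inv w (suc i)
inv-<-from-ℓ-< w i 1≤i ℓ< with <-cmp (inv w i) (inv w (suc i))
... | tri< lt _ _ = lt
... | tri≈ _ eq _ = contradiction (trans (sym (fun-inv w i)) (trans (cong (fun w) eq) (fun-inv w (suc i))))
                                  (<⇒≢ (n<1+n i))
... | tri> _ _ gt = contradiction ℓ< (≤⇒≯ ℓsw≤ℓw)
  where
  open ≤-Reasoning
  M : ℕ
  M = suc (suc i) ⊔ bound w
  no-ascent : ∀ {a b} → a < b → fun w a ≡ i → fun w b ≢ suc i
  no-ascent a<b fa≡i fb≡1+i =
    <-asym gt (subst₂ _<_ (fun≡⇒≡inv w fa≡i) (fun≡⇒≡inv w fb≡1+i) a<b)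
  ℓsw≤ℓw : ℓ (sw i 1≤i w) ≤ ℓ w
  ℓsw≤ℓw = begin
    inversionsBelow M (swap i ∘ fun w) ≤⟨ inversionsBelow-swap-≤ i (fun w) M no-ascent ⟩
    inversionsBelow M (fun w)          ≡⟨ ℓ-beyond-bound w (m≤n⊔m (suc (suc i)) (bound w)) ⟩
    ℓ w                                ∎

-- Increasing vectors and insertion sort

infix 4 _∈_ _∉_

_∈_ : ∀ {l} → ℕ → Vec ℕ l → Set
x ∈ v = ∃ λ j → lookup v j ≡ x

_∉_ : ∀ {l} → ℕ → Vec ℕ l → Set
x ∉ v = ¬ x ∈ v

_∈?_ : ∀ {l} x (v : Vec ℕ l) → Dec (x ∈ v)
x ∈? v = FinP.any? (λ j → lookup v j ≟ x)

record Increasing {l} (v : Vec ℕ l) : Set where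
  constructor increasing
  field monotone : ∀ (j k : Fin l) → j Fin.< k → lookup v j < lookup v k

record Distinct {l} (v : Vec ℕ l) : Set where
  constructor distinct
  field injective : Injective _≡_ _≡_ (lookup v)

open Increasing public
open Distinct public

module _ {l} {v : Vec ℕ l} (v-inc : Increasing v) where

  Increasing⇒Distinct : Distinct v
  Increasing⇒Distinct = distinct lookup-injective
    where
    lookup-injective : Injective _≡_ _≡_ (lookup v)
    lookup-injective {j} {k} e with FinP.<-cmp j k
    ... | tri< j<k _ _ = contradiction e (<⇒≢ (monotone v-inc j k j<k))
    ... | tri≈ _ j≡k _ = j≡k
    ... | tri> _ _ k<j = contradiction (sym e) (<⇒≢ (monotone v-inc k j k<j))

  Increasing-reflects-< : ∀ {j k} → lookup v j < lookup v k → j Fin.< k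
  Increasing-reflects-< {j} {k} lt with FinP.<-cmp j k
  ... | tri< j<k _ _ = j<k
  ... | tri≈ _ refl _ = contradiction lt (<-irrefl refl)
  ... | tri> _ _ k<j = contradiction (monotone v-inc k j k<j) (<-asym lt)

Increasing-∷ : ∀ {l x} {v : Vec ℕ l} → Increasing v → (∀ {y} → y ∈ v → x < y) → Increasing (x ∷ v)
Increasing-∷ {x = x} {v} v-inc x<v = increasing x∷v-monotone
  where
  x∷v-monotone : ∀ j k → j Fin.< k → lookup (x ∷ v) j < lookup (x ∷ v) k
  x∷v-monotone zero    (suc k) _         = x<v (k , refl)
  x∷v-monotone (suc j) (suc k) (s≤s j<k) = monotone v-inc j k j<k

Increasing-tail : ∀ {l x} {v : Vec ℕ l} → Increasing (x ∷ v) → Increasing v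
Increasing-tail inc = increasing λ j k j<k → monotone inc (suc j) (suc k) (s≤s j<k)

Increasing-head : ∀ {l x y} {v : Vec ℕ l} → Increasing (x ∷ v) → y ∈ v → x < y
Increasing-head inc (k , refl) = monotone inc zero (suc k) (s≤s z≤n)

∈-insert⁻ : ∀ {l x y} (v : Vec ℕ l) → x ∈ insert y v → x ≡ y ⊎ x ∈ v
∈-insert⁻ []       (zero , e) = inj₁ (sym e)
∈-insert⁻ {y = y} (z ∷ zs) (j , e) with y ≤? z | j
... | yes _ | zero  = inj₁ (sym e)
... | yes _ | suc k = inj₂ (k , e)
... | no _  | zero  = inj₂ (zero , e)
... | no _  | suc k with ∈-insert⁻ zs (k , e)
...   | inj₁ x≡y      = inj₁ x≡y
...   | inj₂ (m , e′) = inj₂ (suc m , e′)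

∈-insert-here : ∀ {l} y (v : Vec ℕ l) → y ∈ insert y v
∈-insert-here y [] = zero , refl
∈-insert-here y (z ∷ zs) with y ≤? z
... | yes _ = zero , refl
... | no _ with ∈-insert-here y zs
...   | (k , e) = suc k , e

∈-insert-there : ∀ {l x} y (v : Vec ℕ l) → x ∈ v → x ∈ insert y v
∈-insert-there y (z ∷ zs) (j , e) with y ≤? z
∈-insert-there y (z ∷ zs) (j , e)     | yes _ = suc j , e
∈-insert-there y (z ∷ zs) (zero , e)  | no _  = zero , e
∈-insert-there y (z ∷ zs) (suc k , e) | no _ with ∈-insert-there y zs (k , e)
...   | (m , e′) = suc m , e′

∈-sort⁻ : ∀ {l x} (v : Vec ℕ l) → x ∈ sort v → x ∈ v
∈-sort⁻ (y ∷ ys) x∈ with ∈-insert⁻ (sort ys) x∈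
... | inj₁ refl = zero , refl
... | inj₂ x∈sort-ys with ∈-sort⁻ ys x∈sort-ys
...   | (k , e) = suc k , e

∈-sort⁺ : ∀ {l x} (v : Vec ℕ l) → x ∈ v → x ∈ sort v
∈-sort⁺ (y ∷ ys) (zero , refl) = ∈-insert-here y (sort ys)
∈-sort⁺ (y ∷ ys) (suc j , e)   = ∈-insert-there y (sort ys) (∈-sort⁺ ys (j , e))

Increasing-insert : ∀ {l} y (v : Vec ℕ l) → Increasing v → y ∉ v → Increasing (insert y v)
Increasing-insert y [] _ _ = Increasing-∷ (increasing λ ()) (λ ())
Increasing-insert y (z ∷ zs) inc y∉ with y ≤? z
... | yes y≤z = Increasing-∷ inc y<
  where
  y<z : y < z
  y<z = ≤∧≢⇒< y≤z (λ y≡z → y∉ (zero , sym y≡z))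
  y< : ∀ {x} → x ∈ z ∷ zs → y < x
  y< (zero , refl)  = y<z
  y< (suc k , refl) = <-trans y<z (Increasing-head inc (k , refl))
... | no y≰z = Increasing-∷ (Increasing-insert y zs (Increasing-tail inc) (λ { (k , e) → y∉ (suc k , e) })) z<
  where
  z< : ∀ {x} → x ∈ insert y zs → z < x
  z< x∈ with ∈-insert⁻ zs x∈
  ... | inj₁ refl = ≰⇒> y≰z
  ... | inj₂ x∈zs = Increasing-head inc x∈zs

Increasing-sort : ∀ {l} (v : Vec ℕ l) → Distinct v → Increasing (sort v)
Increasing-sort []       _ = increasing λ ()
Increasing-sort (y ∷ ys) d =
  Increasing-insert y (sort ys) (Increasing-sort ys (distinct (FinP.suc-injective ∘ injective d)))
                    (y∉ys ∘ ∈-sort⁻ ys)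
  where
  y∉ys : y ∉ ys
  y∉ys (k , e) with injective d {zero} {suc k} (sym e)
  ... | ()

Increasing-unique : ∀ {l} {u v : Vec ℕ l} → Increasing u → Increasing v →
                    (∀ {x} → x ∈ u → x ∈ v) → (∀ {x} → x ∈ v → x ∈ u) → u ≡ v
Increasing-unique {u = []}    {[]}    _     _     _   _   = refl
Increasing-unique {u = a ∷ u} {b ∷ v} u-inc v-inc u⊆v v⊆u =
  cong₂ _∷_ a≡b (Increasing-unique (Increasing-tail u-inc) (Increasing-tail v-inc) tail⊆ tail⊇)
  where
  a≡b : a ≡ b
  a≡b with u⊆v (zero , refl) | v⊆u (zero , refl)
  ... | (zero , e)  | _           = sym e
  ... | (suc _ , _) | (zero , e)  = e
  ... | (suc k , e) | (suc m , e′) =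
    contradiction (subst (a <_) e′ (Increasing-head u-inc (m , refl)))
                  (<-asym (subst (b <_) e (Increasing-head v-inc (k , refl))))
  tail⊆ : ∀ {x} → x ∈ u → x ∈ v
  tail⊆ (k , e) with u⊆v (suc k , e)
  ... | (zero , e′)  = contradiction (trans a≡b e′) (<⇒≢ (Increasing-head u-inc (k , e)))
  ... | (suc m , e′) = m , e′
  tail⊇ : ∀ {x} → x ∈ v → x ∈ u
  tail⊇ (k , e) with v⊆u (suc k , e)
  ... | (zero , e′)  = contradiction (trans (sym a≡b) e′) (<⇒≢ (Increasing-head v-inc (k , e)))
  ... | (suc m , e′) = m , e′

sort-unique : ∀ {l} {v ε : Vec ℕ l} → Distinct v → Increasing ε →
              (∀ {x} → x ∈ v → x ∈ ε) → (∀ {x} → x ∈ ε → x ∈ v) → sort v ≡ ε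
sort-unique {v = v} d ε-inc v⊆ε ε⊆v =
  Increasing-unique (Increasing-sort v d) ε-inc (v⊆ε ∘ ∈-sort⁻ v) (∈-sort⁺ v ∘ ε⊆v)

lookup∘update-≢ : ∀ {l} (δ : Vec ℕ l) {j m} b → j ≢ m → lookup (δ [ j ]≔ b) m ≡ lookup δ m
lookup∘update-≢ δ b j≢m = lookup∘update′ (j≢m ∘ sym) δ b

Increasing-update : ∀ {l} (δ : Vec ℕ l) j b → Increasing δ →
                    (∀ m → m Fin.< j → lookup δ m < b) → (∀ m → j Fin.< m → b < lookup δ m) →
                    Increasing (δ [ j ]≔ b)
Increasing-update δ j b inc below above = increasing updated-monotone
  where
  updated-monotone : ∀ m n → m Fin.< n → lookup (δ [ j ]≔ b) m < lookup (δ [ j ]≔ b) n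
  updated-monotone m n m<n with j FinP.≟ m | j FinP.≟ n
  ... | yes refl | yes refl = contradiction m<n (FinP.<-irrefl refl)
  ... | yes refl | no j≢n   =
    subst₂ _<_ (sym (lookup∘update j δ b)) (sym (lookup∘update-≢ δ b j≢n)) (above n m<n)
  ... | no j≢m   | yes refl =
    subst₂ _<_ (sym (lookup∘update-≢ δ b j≢m)) (sym (lookup∘update j δ b)) (below m m<n)
  ... | no j≢m   | no j≢n   =
    subst₂ _<_ (sym (lookup∘update-≢ δ b j≢m)) (sym (lookup∘update-≢ δ b j≢n)) (monotone inc m n m<n)

update-≤ᵥ : ∀ {l} (δ γ : Vec ℕ l) j b → (∀ m → j ≢ m → lookup δ m ≤ lookup γ m) → b ≤ lookup γ j →
            (δ [ j ]≔ b) ≤ᵥ γ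
update-≤ᵥ δ γ j b off at m with j FinP.≟ m
... | yes refl = subst (_≤ lookup γ j) (sym (lookup∘update j δ b)) at
... | no j≢m   = subst (_≤ lookup γ m) (sym (lookup∘update-≢ δ b j≢m)) (off m j≢m)

-- The action of sᵢ on increasing sequences

module _ (i : ℕ) where

  swap-injective : ∀ {x y} → swap i x ≡ swap i y → x ≡ y
  swap-injective {x} {y} e = trans (sym (swap-invol i x)) (trans (cong (swap i) e) (swap-invol i y))

  ∈-map-swap⁻ : ∀ {l x} (v : Vec ℕ l) → x ∈ Vec.map (swap i) v → swap i x ∈ v
  ∈-map-swap⁻ v (j , e) = j , trans (sym (swap-invol i _)) (cong (swap i) (trans (sym (lookup-map j (swap i) v)) e))

  ∈-map-swap⁺ : ∀ {l x} (v : Vec ℕ l) → swap i x ∈ v → x ∈ Vec.map (swap i) v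
  ∈-map-swap⁺ {x = x} v (j , e) = j , trans (lookup-map j (swap i) v) (trans (cong (swap i) e) (swap-invol i x))

  Distinct-map-swap : ∀ {l} {v : Vec ℕ l} → Distinct v → Distinct (Vec.map (swap i) v)
  Distinct-map-swap {v = v} d = distinct λ {j} {k} e →
    injective d (swap-injective (trans (sym (lookup-map j (swap i) v)) (trans e (lookup-map k (swap i) v))))

  ∈-sα⁻ : ∀ {l x} {β : Vec ℕ l} → x ∈ sα i β → swap i x ∈ β
  ∈-sα⁻ {β = β} = ∈-map-swap⁻ β ∘ ∈-sort⁻ (Vec.map (swap i) β)

  ∈-sα⁺ : ∀ {l x} {β : Vec ℕ l} → swap i x ∈ β → x ∈ sα i β
  ∈-sα⁺ {β = β} = ∈-sort⁺ (Vec.map (swap i) β) ∘ ∈-map-swap⁺ β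

  Increasing-sα : ∀ {l} {β : Vec ℕ l} → Distinct β → Increasing (sα i β)
  Increasing-sα {β = β} d = Increasing-sort (Vec.map (swap i) β) (Distinct-map-swap d)

  sα-unique : ∀ {l} {β ε : Vec ℕ l} → Distinct β → Increasing ε →
              (∀ {x} → x ∈ ε → swap i x ∈ β) → (∀ {x} → swap i x ∈ β → x ∈ ε) → sα i β ≡ ε
  sα-unique {β = β} d ε-inc ε⊆ ⊆ε =
    sort-unique (Distinct-map-swap d) ε-inc (⊆ε ∘ ∈-map-swap⁻ β) (∈-map-swap⁺ β ∘ ε⊆)

  sα-sort : ∀ {l} (v : Vec ℕ l) → Distinct v → sα i (sort v) ≡ sort (Vec.map (swap i) v)
  sα-sort v d = sym (sort-unique (Distinct-map-swap d) (Increasing-sα (Increasing⇒Distinct (Increasing-sort v d)))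
                                 (∈-sα⁺ {β = sort v} ∘ ∈-sort⁺ v ∘ ∈-map-swap⁻ v)
                                 (∈-map-swap⁺ v ∘ ∈-sort⁻ v ∘ ∈-sα⁻ {β = sort v}))

  swap-preserves-∈ : ∀ {l x} {β : Vec ℕ l} → (i ∈ β → suc i ∈ β) → (suc i ∈ β → i ∈ β) →
                     x ∈ β → swap i x ∈ β
  swap-preserves-∈ {x = x} {β} up down x∈ with swapView i x
  ... | at-i refl sx      = subst (_∈ β) (sym sx) (up x∈)
  ... | at-suc-i refl sx  = subst (_∈ β) (sym sx) (down x∈)
  ... | elsewhere _ _ sx  = subst (_∈ β) (sym sx) x∈

  sα-fixed : ∀ {l} {β : Vec ℕ l} → Increasing β → (i ∈ β → suc i ∈ β) → (suc i ∈ β → i ∈ β) →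
             sα i β ≡ β
  sα-fixed {β = β} inc up down = sα-unique (Increasing⇒Distinct inc) inc (swap-preserves-∈ {β = β} up down)
    (λ {x} sx∈ → subst (_∈ β) (swap-invol i x) (swap-preserves-∈ {β = β} up down sx∈))

  sα-exchange : ∀ {l} {β : Vec ℕ l} {j a b} → Increasing β → lookup β j ≡ a → b ∉ β → swap i a ≡ b →
                (∀ {x} → x ≢ a → x ≢ b → swap i x ≡ x) → Increasing (β [ j ]≔ b) →
                sα i β ≡ β [ j ]≔ b
  sα-exchange {β = β} {j} {a} {b} inc βj≡a b∉β sa≡b others inc′ =
    sα-unique (Increasing⇒Distinct inc) inc′ ⊆β ⊇β
    where
    sb≡a : swap i b ≡ a
    sb≡a = trans (cong (swap i) (sym sa≡b)) (swap-invol i a)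
    fixed-off-j : ∀ {m} → j ≢ m → swap i (lookup β m) ≡ lookup β m
    fixed-off-j {m} j≢m =
      others (j≢m ∘ injective (Increasing⇒Distinct inc) ∘ trans βj≡a ∘ sym) (b∉β ∘ (m ,_))
    ⊆β : ∀ {x} → x ∈ β [ j ]≔ b → swap i x ∈ β
    ⊆β (m , e) with j FinP.≟ m
    ... | yes refl = j , trans βj≡a (trans (sym sb≡a) (cong (swap i) (trans (sym (lookup∘update j β b)) e)))
    ... | no j≢m   = m , trans (sym (fixed-off-j j≢m)) (cong (swap i) (trans (sym (lookup∘update-≢ β b j≢m)) e))
    ⊇β : ∀ {x} → swap i x ∈ β → x ∈ β [ j ]≔ b
    ⊇β (m , e) with j FinP.≟ m
    ... | yes refl = j , trans (lookup∘update j β b) (swap-injective (trans sb≡a (trans (sym βj≡a) e)))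
    ... | no j≢m   = m , trans (lookup∘update-≢ β b j≢m) (swap-injective (trans (fixed-off-j j≢m) e))

  sα-raise : ∀ {l} {β : Vec ℕ l} {j} → Increasing β → lookup β j ≡ i → suc i ∉ β →
             sα i β ≡ β [ j ]≔ suc i
  sα-raise {β = β} {j} inc βj≡i 1+i∉β =
    sα-exchange inc βj≡i 1+i∉β (swap-i i) (swap-other i _)
      (Increasing-update β j (suc i) inc
        (λ m m<j → m<n⇒m<1+n (subst (lookup β m <_) βj≡i (monotone inc m j m<j)))
        (λ m j<m → ≤∧≢⇒< (subst (_< lookup β m) βj≡i (monotone inc j m j<m)) (λ e → 1+i∉β (m , sym e))))

  sα-lower : ∀ {l} {β : Vec ℕ l} {j} → Increasing β → lookup β j ≡ suc i → i ∉ β →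
             sα i β ≡ β [ j ]≔ i
  sα-lower {β = β} {j} inc βj≡1+i i∉β =
    sα-exchange inc βj≡1+i i∉β (swap-si i) (λ x≢1+i x≢i → swap-other i _ x≢i x≢1+i)
      (Increasing-update β j i inc
        (λ m m<j → ≤∧≢⇒< (≤-pred (subst (lookup β m <_) βj≡1+i (monotone inc m j m<j)))
                         (λ e → i∉β (m , e)))
        (λ m j<m → <-trans (n<1+n i) (subst (_< lookup β m) βj≡1+i (monotone inc j m j<m))))

data SwapShape (i : ℕ) {l} (β : Vec ℕ l) : Set where
  fixed   : (i ∈ β → suc i ∈ β) → sα i β ≡ β → SwapShape i β
  raised  : ∀ j → lookup β j ≡ i → suc i ∉ β → sα i β ≡ β [ j ]≔ suc i → SwapShape i β
  lowered : ∀ j → lookup β j ≡ suc i → i ∉ β → sα i β ≡ β [ j ]≔ i → SwapShape i β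

swapShape : ∀ i {l} {β : Vec ℕ l} → Increasing β → SwapShape i β
swapShape i {β = β} inc with i ∈? β | suc i ∈? β
... | yes i∈β        | yes 1+i∈β        = fixed (λ _ → 1+i∈β) (sα-fixed i inc (λ _ → 1+i∈β) (λ _ → i∈β))
... | no i∉β         | no 1+i∉β         = fixed up (sα-fixed i inc up (λ 1+i∈β → contradiction 1+i∈β 1+i∉β))
  where
  up : i ∈ β → suc i ∈ β
  up i∈β = contradiction i∈β i∉β
... | yes (j , βj≡i) | no 1+i∉β         = raised j βj≡i 1+i∉β (sα-raise i inc βj≡i 1+i∉β)
... | no i∉β         | yes (j , βj≡1+i) = lowered j βj≡1+i i∉β (sα-lower i inc βj≡1+i i∉β)

IncPos-sα : ∀ {i l} {β : Vec ℕ l} → 1 ≤ i → IncPos β → IncPos (sα i β)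
IncPos-sα {i} {β = β} 1≤i (pos , inc) =
  positive , monotone (Increasing-sα i {β = β} (Increasing⇒Distinct (increasing inc)))
  where
  positive : ∀ j → 1 ≤ lookup (sα i β) j
  positive j with lookup (sα i β) j | ∈-sα⁻ i {β = β} (j , refl)
  ... | zero  | (m , βm≡s0) = contradiction (trans βm≡s0 (fix0 (s i 1≤i))) (<⇒≢ (pos m) ∘ sym)
  ... | suc _ | _           = s≤s z≤n

-- The sets A(γ)

-- A (wl w l) is the paper's A_l(w); InA w l unfolds to it.
A : ∀ {l} → Vec ℕ l → Vec ℕ l → Set
A γ α = IncPos α × α ≤ᵥ γ

Aᵢ : ℕ → ∀ {l} → Vec ℕ l → Vec ℕ l → Set
Aᵢ i γ β = A γ β × ¬ A γ (sα i β)

sα[Aᵢ] : ℕ → ∀ {l} → Vec ℕ l → Vec ℕ l → Set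
sα[Aᵢ] i {l} γ α = ∃ λ (β : Vec ℕ l) → Aᵢ i γ β × α ≡ sα i β

A-sα[Aᵢ]-disjoint : ∀ {i l} {γ α : Vec ℕ l} → ¬ (A γ α × sα[Aᵢ] i γ α)
A-sα[Aᵢ]-disjoint (α∈A , _ , (_ , sβ∉A) , refl) = sβ∉A α∈A

sα-≤ᵥ : ∀ {i l} {β γ : Vec ℕ l} → Increasing β → β ≤ᵥ γ →
        (∀ {j} → lookup β j ≡ i → suc i ∉ β → suc i ≤ lookup γ j) → sα i β ≤ᵥ γ
sα-≤ᵥ {i} {β = β} {γ} β-inc β≤γ raise-fits with swapShape i β-inc
... | fixed _ eq = subst (_≤ᵥ γ) (sym eq) β≤γ
... | raised j βj≡i 1+i∉β eq =
  subst (_≤ᵥ γ) (sym eq) (update-≤ᵥ β γ j (suc i) (λ m _ → β≤γ m) (raise-fits βj≡i 1+i∉β))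
... | lowered j βj≡1+i _ eq =
  subst (_≤ᵥ γ) (sym eq)
    (update-≤ᵥ β γ j i (λ m _ → β≤γ m) (≤-trans (n≤1+n i) (subst (_≤ lookup γ j) βj≡1+i (β≤γ j))))

module _ {i l} {γ : Vec ℕ l} (1≤i : 1 ≤ i) (γ-inc : Increasing γ) where

  A-sα-closed : ∀ {β} → (i ∈ γ → suc i ∈ γ) → A γ β → A γ (sα i β)
  A-sα-closed {β} up (β-pos , β≤γ) = IncPos-sα {β = β} 1≤i β-pos , sα-≤ᵥ {γ = γ} β-inc β≤γ raise-fits
    where
    β-inc : Increasing β
    β-inc = increasing (proj₂ β-pos)
    raise-fits : ∀ {j} → lookup β j ≡ i → suc i ∉ β → suc i ≤ lookup γ j
    raise-fits {j} βj≡i 1+i∉β = ≤∧≢⇒< (subst (_≤ lookup γ j) βj≡i (β≤γ j)) (γj≢i ∘ sym)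
      where
      γj≢i : lookup γ j ≢ i
      γj≢i γj≡i with up (j , γj≡i)
      ... | (m , γm≡1+i) = 1+i∉β (m , ≤-antisym (subst (lookup β m ≤_) γm≡1+i (β≤γ m)) i<βm)
        where
        i<βm : i < lookup β m
        i<βm = subst (_< lookup β m) βj≡i
          (monotone β-inc j m (Increasing-reflects-< γ-inc (subst₂ _<_ (sym γj≡i) (sym γm≡1+i) (n<1+n i))))

  module _ {k} (γk≡i : lookup γ k ≡ i) (1+i∉γ : suc i ∉ γ) where

    γ≤ᵥraised : γ ≤ᵥ (γ [ k ]≔ suc i)
    γ≤ᵥraised m with k FinP.≟ m
    ... | yes refl = subst₂ _≤_ (sym γk≡i) (sym (lookup∘update k γ (suc i))) (n≤1+n i)
    ... | no k≢m   = ≤-reflexive (sym (lookup∘update-≢ γ (suc i) k≢m))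

    A-raised⁻ : ∀ {α} → A (γ [ k ]≔ suc i) α → A γ α ⊎ sα[Aᵢ] i γ α
    A-raised⁻ {α} (α-pos , α≤γ′) with lookup α k ≤? i
    ... | yes αk≤i = inj₁ (α-pos , α≤γ)
      where
      α≤γ : α ≤ᵥ γ
      α≤γ m with k FinP.≟ m
      ... | yes refl = subst (lookup α k ≤_) (sym γk≡i) αk≤i
      ... | no k≢m   = subst (lookup α m ≤_) (lookup∘update-≢ γ (suc i) k≢m) (α≤γ′ m)
    ... | no αk≰i = inj₂ (β , ((β-pos , β≤γ) , sβ∉A) , sym sβ≡α)
      where
      α-inc : Increasing α
      α-inc = increasing (proj₂ α-pos)
      αk≡1+i : lookup α k ≡ suc i
      αk≡1+i = ≤-antisym (subst (lookup α k ≤_) (lookup∘update k γ (suc i)) (α≤γ′ k)) (≰⇒> αk≰i)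
      β : Vec ℕ l
      β = α [ k ]≔ i
      α≤γ-off-k : ∀ m → k ≢ m → lookup α m ≤ lookup γ m
      α≤γ-off-k m k≢m = subst (lookup α m ≤_) (lookup∘update-≢ γ (suc i) k≢m) (α≤γ′ m)
      β-inc : Increasing β
      β-inc = Increasing-update α k i α-inc
        (λ m m<k → ≤-<-trans (α≤γ-off-k m (FinP.<⇒≢ m<k ∘ sym))
                             (subst (lookup γ m <_) γk≡i (monotone γ-inc m k m<k)))
        (λ m k<m → <-trans (n<1+n i) (subst (_< lookup α m) αk≡1+i (monotone α-inc k m k<m)))
      β-pos : IncPos β
      β-pos = positive , monotone β-inc
        where
        positive : ∀ m → 1 ≤ lookup β m
        positive m with k FinP.≟ m
        ... | yes refl = subst (1 ≤_) (sym (lookup∘update k α i)) 1≤i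
        ... | no k≢m   = subst (1 ≤_) (sym (lookup∘update-≢ α i k≢m)) (proj₁ α-pos m)
      β≤γ : β ≤ᵥ γ
      β≤γ = update-≤ᵥ α γ k i α≤γ-off-k (≤-reflexive (sym γk≡i))
      1+i∉β : suc i ∉ β
      1+i∉β (m , βm≡1+i) with k FinP.≟ m
      ... | yes refl = 1+n≢n (trans (sym βm≡1+i) (lookup∘update k α i))
      ... | no k≢m   = k≢m (injective (Increasing⇒Distinct α-inc)
                             (trans αk≡1+i (trans (sym βm≡1+i) (lookup∘update-≢ α i k≢m))))
      sβ≡α : sα i β ≡ α
      sβ≡α = begin
        sα i β                    ≡⟨ sα-raise i β-inc (lookup∘update k α i) 1+i∉β ⟩
        β [ k ]≔ suc i            ≡⟨ []≔-idempotent α k ⟩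
        α [ k ]≔ suc i            ≡⟨ cong (α [ k ]≔_) (sym αk≡1+i) ⟩
        α [ k ]≔ lookup α k       ≡⟨ []≔-lookup α k ⟩
        α                         ∎
        where open ≡-Reasoning
      sβ∉A : ¬ A γ (sα i β)
      sβ∉A (_ , sβ≤γ) =
        1+n≰n (subst₂ _≤_ αk≡1+i γk≡i (subst (λ δ → lookup δ k ≤ lookup γ k) sβ≡α (sβ≤γ k)))

    A-raised⁺ : ∀ {α} → A γ α ⊎ sα[Aᵢ] i γ α → A (γ [ k ]≔ suc i) α
    A-raised⁺ (inj₁ (α-pos , α≤γ)) = α-pos , λ m → ≤-trans (α≤γ m) (γ≤ᵥraised m)
    A-raised⁺ (inj₂ (β , ((β-pos , β≤γ) , _) , refl)) =
        IncPos-sα {β = β} 1≤i β-pos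
      , sα-≤ᵥ {β = β} {γ [ k ]≔ suc i} (increasing (proj₂ β-pos))
              (λ m → ≤-trans (β≤γ m) (γ≤ᵥraised m)) raise-fits
      where
      raise-fits : ∀ {j} → lookup β j ≡ i → suc i ∉ β → suc i ≤ lookup (γ [ k ]≔ suc i) j
      raise-fits {j} βj≡i _ with k FinP.≟ j
      ... | yes refl = ≤-reflexive (sym (lookup∘update k γ (suc i)))
      ... | no k≢j   = subst (suc i ≤_) (sym (lookup∘update-≢ γ (suc i) k≢j))
                         (≤∧≢⇒< (subst (_≤ lookup γ j) βj≡i (β≤γ j))
                                (λ i≡γj → k≢j (injective (Increasing⇒Distinct γ-inc) (trans γk≡i i≡γj))))

  module _ (down : suc i ∈ γ → i ∈ γ) where

    A-sα⁻ : ∀ {α} → A (sα i γ) α → A γ α ⊎ sα[Aᵢ] i γ α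
    A-sα⁻ {α} with swapShape i γ-inc
    ... | fixed _ eq              = inj₁ ∘ subst (λ δ → A δ α) eq
    ... | raised k γk≡i 1+i∉γ eq  = A-raised⁻ γk≡i 1+i∉γ ∘ subst (λ δ → A δ α) eq
    ... | lowered j γj≡1+i i∉γ _  = contradiction (down (j , γj≡1+i)) i∉γ

    A-sα⁺ : ∀ {α} → A γ α ⊎ sα[Aᵢ] i γ α → A (sα i γ) α
    A-sα⁺ {α} with swapShape i γ-inc
    ... | fixed up eq             = subst (λ δ → A δ α) (sym eq) ∘ sα[Aᵢ]-empty
      where
      sα[Aᵢ]-empty : A γ α ⊎ sα[Aᵢ] i γ α → A γ α
      sα[Aᵢ]-empty (inj₁ α∈A)                     = α∈A
      sα[Aᵢ]-empty (inj₂ (β , (β∈A , sβ∉A) , _)) = contradiction (A-sα-closed {β = β} up β∈A) sβ∉A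
    ... | raised k γk≡i 1+i∉γ eq  = subst (λ δ → A δ α) (sym eq) ∘ A-raised⁺ γk≡i 1+i∉γ
    ... | lowered j γj≡1+i i∉γ _  = contradiction (down (j , γj≡1+i)) i∉γ

sα-reverses-ascent : ∀ {i l} {γ : Vec ℕ l} → (suc i ∈ γ → i ∈ γ) → i ∈ sα i γ → suc i ∈ sα i γ
sα-reverses-ascent {i} {γ = γ} down i∈sγ =
  ∈-sα⁺ i {β = γ}
    (subst (_∈ γ) (sym (swap-si i)) (down (subst (_∈ γ) (swap-i i) (∈-sα⁻ i {β = γ} i∈sγ))))

Aᵢ-self : ∀ {i l} {γ : Vec ℕ l} {k} → IncPos γ → lookup γ k ≡ i → suc i ∉ γ → Aᵢ i γ γ
Aᵢ-self {i} {γ = γ} {k} γ-pos γk≡i 1+i∉γ = (γ-pos , λ _ → ≤-refl) , sγ∉A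
  where
  sγk≡1+i : lookup (sα i γ) k ≡ suc i
  sγk≡1+i = trans (cong (λ δ → lookup δ k) (sα-raise i {β = γ} (increasing (proj₂ γ-pos)) γk≡i 1+i∉γ))
                  (lookup∘update k γ (suc i))
  sγ∉A : ¬ A γ (sα i γ)
  sγ∉A (_ , sγ≤γ) = 1+n≰n (subst₂ _≤_ sγk≡1+i γk≡i (sγ≤γ k))

-- The sequences w^l

module _ (w : Perm) where

  images : ∀ l → Vec ℕ l
  images l = tabulate (λ (j : Fin l) → fun w (suc (toℕ j)))

  lookup-images : ∀ {l} (j : Fin l) → lookup (images l) j ≡ fun w (suc (toℕ j))
  lookup-images = lookup∘tabulate (λ j → fun w (suc (toℕ j)))

  images-Distinct : ∀ l → Distinct (images l)
  images-Distinct l = distinct λ {j} {k} e →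
    FinP.toℕ-injective (suc-injective (fun-injective w (trans (sym (lookup-images j)) (trans e (lookup-images k)))))

  wl-Increasing : ∀ l → Increasing (wl w l)
  wl-Increasing l = Increasing-sort (images l) (images-Distinct l)

  ∈-wl⁻ : ∀ {l x} → x ∈ wl w l → ∃ λ (j : Fin l) → fun w (suc (toℕ j)) ≡ x
  ∈-wl⁻ {l} x∈ with ∈-sort⁻ (images l) x∈
  ... | (j , e) = j , trans (sym (lookup-images j)) e

  ∈-wl⇒inv≤ : ∀ {l x} → x ∈ wl w l → inv w x ≤ l
  ∈-wl⇒inv≤ x∈ with ∈-wl⁻ x∈
  ... | (j , e) = subst (_≤ _) (fun≡⇒≡inv w e) (FinP.toℕ<n j)

  inv≤⇒∈-wl : ∀ {l x} → 1 ≤ inv w x → inv w x ≤ l → x ∈ wl w l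
  inv≤⇒∈-wl {l} {x} 1≤inv inv≤l with inv w x | fun-inv w x
  ... | suc r | fun-r≡x = ∈-sort⁺ (images l)
    (Fin.fromℕ< inv≤l , trans (lookup-images (Fin.fromℕ< inv≤l))
                              (trans (cong (fun w ∘ suc) (FinP.toℕ-fromℕ< inv≤l)) fun-r≡x))

  fun-positive : ∀ {r} → 1 ≤ r → 1 ≤ fun w r
  fun-positive 1≤r = n≢0⇒n>0 λ fr≡0 → <⇒≢ 1≤r (sym (fun-injective w (trans fr≡0 (sym (fix0 w)))))

  inv-positive : ∀ {x} → 1 ≤ x → 1 ≤ inv w x
  inv-positive {x} 1≤x = n≢0⇒n>0 λ inv≡0 →
    <⇒≢ 1≤x (sym (trans (sym (fun-inv w x)) (trans (cong (fun w) inv≡0) (fix0 w))))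

  wl-IncPos : ∀ l → IncPos (wl w l)
  wl-IncPos l = positive , monotone (wl-Increasing l)
    where
    positive : ∀ j → 1 ≤ lookup (wl w l) j
    positive j with ∈-wl⁻ (j , refl)
    ... | (m , e) = subst (1 ≤_) e (fun-positive (s≤s z≤n))

  wl-sw : ∀ i (1≤i : 1 ≤ i) l → wl (sw i 1≤i w) l ≡ sα i (wl w l)
  wl-sw i 1≤i l = trans (cong sort (tabulate-∘ (swap i) (λ j → fun w (suc (toℕ j)))))
                        (sym (sα-sort i (images l) (images-Distinct l)))

module Ascent (w : Perm) {i} (1≤i : 1 ≤ i) (i-before-1+i : inv w i < inv w (suc i)) where

  wl-1+i⇒i : ∀ {l} → suc i ∈ wl w l → i ∈ wl w l
  wl-1+i⇒i 1+i∈ = inv≤⇒∈-wl w (inv-positive w 1≤i) (<⇒≤ (<-≤-trans i-before-1+i (∈-wl⇒inv≤ w 1+i∈)))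

  InA-sw≡A : ∀ l α → InA (sw i 1≤i w) l α ≡ A (sα i (wl w l)) α
  InA-sw≡A l α = cong (λ γ → A γ α) (wl-sw w i 1≤i l)

  InA-sw⁻ : ∀ l α → InA (sw i 1≤i w) l α → InA w l α ⊎ sα[Aᵢ] i (wl w l) α
  InA-sw⁻ l α = A-sα⁻ 1≤i (wl-Increasing w l) wl-1+i⇒i {α} ∘ subst id (InA-sw≡A l α)

  InA-sw⁺ : ∀ l α → InA w l α ⊎ sα[Aᵢ] i (wl w l) α → InA (sw i 1≤i w) l α
  InA-sw⁺ l α = subst id (sym (InA-sw≡A l α)) ∘ A-sα⁺ 1≤i (wl-Increasing w l) wl-1+i⇒i {α}

  InA-sw-sα-closed : ∀ l α → InA (sw i 1≤i w) l α → InA (sw i 1≤i w) l (sα i α)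
  InA-sw-sα-closed l α =
      subst id (sym (InA-sw≡A l (sα i α)))
    ∘ A-sα-closed 1≤i (Increasing-sα i (Increasing⇒Distinct (wl-Increasing w l))) {α}
                  (sα-reverses-ascent {γ = wl w l} wl-1+i⇒i)
    ∘ subst id (InA-sw≡A l α)

  InAi-at-inv : InAi w (inv w i) i (wl w (inv w i))
  InAi-at-inv with inv≤⇒∈-wl w {inv w i} (inv-positive w 1≤i) ≤-refl
  ... | (k , γk≡i) = Aᵢ-self {γ = wl w (inv w i)} (wl-IncPos w (inv w i)) γk≡i
                             (λ 1+i∈ → <⇒≱ i-before-1+i (∈-wl⇒inv≤ w 1+i∈))

proposition1p6 : (w : Perm) (i : ℕ) (1≤i : 1 ≤ i) → ℓ w < ℓ (sw i 1≤i w) →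
    -- disjoint union decomposition, for every l ≥ 1
    ((l : ℕ) → 1 ≤ l → (α : Vec ℕ l) →
      ((InA (sw i 1≤i w) l α → InA w l α ⊎ Σ (Vec ℕ l) (λ β → InAi w l i β × α ≡ sα i β))
       × (InA w l α ⊎ Σ (Vec ℕ l) (λ β → InAi w l i β × α ≡ sα i β) → InA (sw i 1≤i w) l α))
      × ¬ (InA w l α × Σ (Vec ℕ l) (λ β → InAi w l i β × α ≡ sα i β)))
    -- the second part is non-empty for some l ≥ 1
    × Σ ℕ (λ l → 1 ≤ l × Σ (Vec ℕ l) (λ β → InAi w l i β))
    -- consequences
    × ((l : ℕ) → 1 ≤ l → (α : Vec ℕ l) → InA w l α → InA (sw i 1≤i w) l α)
    × ((l : ℕ) → 1 ≤ l → (α : Vec ℕ l) → InA (sw i 1≤i w) l α → InA (sw i 1≤i w) l (sα i α))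
    × Σ ℕ (λ l → 1 ≤ l × Σ (Vec ℕ l) (λ α → InA (sw i 1≤i w) l α × ¬ InA w l α))
proposition1p6 w i 1≤i ℓ< =
    (λ l _ α → (InA-sw⁻ l α , InA-sw⁺ l α) , A-sα[Aᵢ]-disjoint {γ = wl w l} {α})
  , (q , 1≤q , wl w q , InAi-at-inv)
  , (λ l _ α → InA-sw⁺ l α ∘ inj₁)
  , (λ l _ α → InA-sw-sα-closed l α)
  , (q , 1≤q , sα i (wl w q) , InA-sw⁺ q _ (inj₂ (wl w q , InAi-at-inv , refl)) , proj₂ InAi-at-inv)
  where
  open Ascent w 1≤i (inv-<-from-ℓ-< w i 1≤i ℓ<)
  q : ℕ
  q = inv w i
  1≤q : 1 ≤ q
  1≤q = inv-positive w 1≤i
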